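{- For $n\ge 1$ let $D_n$ be the disjointness graph: its vertices are the non-empty proper subsets of $\{1,\dots,n\}$, and two subsets are adjacent if and only if they are disjoint. For $n\in\{1,2\}$ we have $\mathrm{box}(D_n)=\dim_{TH}(D_n)=0$. For $n\ge 3$ we have $\mathrm{box}(D_n)=\dim_{TH}(D_n)=n-1$.
   Context: All graphs are finite and simple. The boxicity $\mathrm{box}(G)$ of a graph $G$ is the minimum integer $d\ge 0$ such that there exist $d$ interval graphs $I_1,\dots,I_d$ on the vertex set $V(G)$ with $E(G)=\bigcap_{j=1}^d E(I_j)$. For a finite set $V$, $\alpha\colon V\to\mathbb{R}$ and $S\in\mathbb{R}$, the threshold graph $T(\alpha,S)$ has vertex set $V$ and edges all $\{v,w\}$, $v\neq w$, with $\alpha(v)+\alpha(w)\ge S$; a graph is a threshold graph if it is of this form. The threshold dimension $\dim_{TH}(G)$ is the minimum $d\ge 0$ such that there exist $d$ threshold graphs $H_1,\dots,H_d$ on $V(G)$ with $E(G)=\bigcap_{j=1}^d E(H_j)$. In both definitions the empty intersection ($d=0$) is the set of all pairs of vertices, so the parameter is $0$ exactly for complete graphs (including the graph with no vertices). -}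

module Defs where

open import Data.Fin.Base using (Fin)
open import Data.Fin.Subset using (Subset; inside; outside; ⊤; _∩_; _⊂_; Nonempty; Empty)
open import Data.Fin.Subset.Properties using (nonempty?; _⊂?_; ∩-comm; ∩-idem)
open import Data.Bool.Properties using () renaming (_≟_ to _≟ᵇ_)
open import Data.Empty using (⊥-elim-irr)
open import Data.Irrelevant using () renaming ([_] to irr)
open import Data.List.Base using (List; []; _∷_; _++_; map; concatMap)
open import Data.List.Relation.Unary.Any using (here)
open import Data.List.Relation.Unary.Enumerates.Setoid using (IsEnumeration)
open import Data.List.Membership.Propositional using (_∈_; lose)
open import Data.List.Membership.Propositional.Properties
  using (∈-map⁺; ∈-++⁺ˡ; ∈-++⁺ʳ; ∈-concatMap⁺)
open import Data.Nat.Base as ℕ using (ℕ; zero; suc; _⊔_)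
import Data.Nat.Properties as ℕ
open import Data.Product.Base using (Σ-syntax; ∃-syntax; _×_; _,_; proj₁)
open import Data.Rational.Base as ℚ using (ℚ; 0ℚ; ½; ∣_∣)
import Data.Rational.Properties as ℚ
open import Data.Refinement using (Refinement-syntax; _,_; value) renaming (_≟_ to ≟-value)
open import Data.Vec.Base using ([]; _∷_)
open import Data.Vec.Properties using (≡-dec)
open import Function.Base using (_∘_)
open import Function.Bundles using (_⇔_)
open import Relation.Binary.Definitions using (DecidableEquality)
open import Relation.Binary.PropositionalEquality
open import Relation.Nullary.Decidable.Core using (Dec; yes; no; _×-dec_)
open import Relation.Nullary.Negation.Core using (¬_)
open import Relation.Unary using (Pred)

IsCauchy : (ℕ → ℚ) → Set
IsCauchy x = ∀ ε → 0ℚ ℚ.< ε →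
  ∃[ N ] ∀ m n → N ℕ.≤ m → N ℕ.≤ n → ∣ x m ℚ.- x n ∣ ℚ.< ε

-- No quotient is taken: x and y represent the same real number when
-- x ≤ᴿ y and y ≤ᴿ x.
record ℝ : Set where
  field
    seq    : ℕ → ℚ
    cauchy : IsCauchy seq

open ℝ public

infix 4 _≤ᴿ_

-- lim x ≤ lim y; the slack ε is needed since comparing the sequences
-- termwise is not invariant under changing representatives.
_≤ᴿ_ : ℝ → ℝ → Set
x ≤ᴿ y = ∀ ε → 0ℚ ℚ.< ε → ∃[ N ] ∀ n → N ℕ.≤ n → seq x n ℚ.< seq y n ℚ.+ ε

private
  halve : ∀ ε → ½ ℚ.* ε ℚ.+ ½ ℚ.* ε ≡ ε
  halve ε = trans (sym (ℚ.*-distribʳ-+ ε ½ ½)) (ℚ.*-identityˡ ε)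

  0<½ε : ∀ {ε} → 0ℚ ℚ.< ε → 0ℚ ℚ.< ½ ℚ.* ε
  0<½ε {ε} 0<ε = subst (ℚ._< ½ ℚ.* ε) (ℚ.*-zeroʳ ½) (ℚ.*-monoʳ-<-pos ½ 0<ε)

  regroup : ∀ a b c d → (a ℚ.+ b) ℚ.- (c ℚ.+ d) ≡ (a ℚ.- c) ℚ.+ (b ℚ.- d)
  regroup a b c d = begin
    (a ℚ.+ b) ℚ.- (c ℚ.+ d)              ≡⟨ cong ((a ℚ.+ b) ℚ.+_) (ℚ.neg-distrib-+ c d) ⟩
    (a ℚ.+ b) ℚ.+ (ℚ.- c ℚ.+ ℚ.- d)      ≡⟨ ℚ.+-assoc a b _ ⟩
    a ℚ.+ (b ℚ.+ (ℚ.- c ℚ.+ ℚ.- d))      ≡⟨ cong (a ℚ.+_) (ℚ.+-assoc b _ _) ⟨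
    a ℚ.+ ((b ℚ.+ ℚ.- c) ℚ.+ ℚ.- d)      ≡⟨ cong (λ t → a ℚ.+ (t ℚ.+ ℚ.- d)) (ℚ.+-comm b _) ⟩
    a ℚ.+ ((ℚ.- c ℚ.+ b) ℚ.+ ℚ.- d)      ≡⟨ cong (a ℚ.+_) (ℚ.+-assoc (ℚ.- c) b _) ⟩
    a ℚ.+ (ℚ.- c ℚ.+ (b ℚ.- d))          ≡⟨ ℚ.+-assoc a _ _ ⟨
    (a ℚ.- c) ℚ.+ (b ℚ.- d)              ∎
    where open ≡-Reasoning

+-cauchy : ∀ {x y} → IsCauchy x → IsCauchy y → IsCauchy (λ n → x n ℚ.+ y n)
+-cauchy {x} {y} cx cy ε 0<ε with cx (½ ℚ.* ε) (0<½ε 0<ε) | cy (½ ℚ.* ε) (0<½ε 0<ε)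
... | M , x-close | N , y-close = M ⊔ N , close
  where
  close : ∀ m n → M ⊔ N ℕ.≤ m → M ⊔ N ℕ.≤ n →
          ∣ (x m ℚ.+ y m) ℚ.- (x n ℚ.+ y n) ∣ ℚ.< ε
  close m n M⊔N≤m M⊔N≤n = begin-strict
    ∣ (x m ℚ.+ y m) ℚ.- (x n ℚ.+ y n) ∣  ≡⟨ cong ∣_∣ (regroup (x m) (y m) (x n) (y n)) ⟩
    ∣ (x m ℚ.- x n) ℚ.+ (y m ℚ.- y n) ∣  ≤⟨ ℚ.∣p+q∣≤∣p∣+∣q∣ (x m ℚ.- x n) (y m ℚ.- y n) ⟩
    ∣ x m ℚ.- x n ∣ ℚ.+ ∣ y m ℚ.- y n ∣  <⟨ ℚ.+-mono-< (x-close m n (ℕ.m⊔n≤o⇒m≤o M N M⊔N≤m) (ℕ.m⊔n≤o⇒m≤o M N M⊔N≤n))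
                                                     (y-close m n (ℕ.m⊔n≤o⇒n≤o M N M⊔N≤m) (ℕ.m⊔n≤o⇒n≤o M N M⊔N≤n)) ⟩
    ½ ℚ.* ε ℚ.+ ½ ℚ.* ε                  ≡⟨ halve ε ⟩
    ε                                    ∎
    where open ℚ.≤-Reasoning

infixl 6 _+ᴿ_

_+ᴿ_ : ℝ → ℝ → ℝ
x +ᴿ y = record
  { seq    = λ n → seq x n ℚ.+ seq y n
  ; cauchy = +-cauchy {seq x} {seq y} (cauchy x) (cauchy y)
  }

+ᴿ-comm-≥ : ∀ {s} x y → s ≤ᴿ x +ᴿ y → s ≤ᴿ y +ᴿ x
+ᴿ-comm-≥ {s} x y s≤x+y ε 0<ε with s≤x+y ε 0<ε
... | N , p = N , λ n N≤n →
  subst (λ t → seq s n ℚ.< t ℚ.+ ε) (ℚ.+-comm (seq x n) (seq y n)) (p n N≤n)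

record FiniteSet : Set₁ where
  field
    Carrier  : Set
    _≟_      : DecidableEquality Carrier
    elements : List Carrier
    complete : IsEnumeration (setoid Carrier) elements

open FiniteSet public using (Carrier)

record Graph (V : FiniteSet) : Set₁ where
  field
    Adj    : Carrier V → Carrier V → Set
    symm   : ∀ {v w} → Adj v w → Adj w v
    irrefl : ∀ {v} → ¬ Adj v v

open Graph public

module _ {V : FiniteSet} where

  infix 4 _≈ᴳ_

  _≈ᴳ_ : Graph V → Graph V → Set
  G ≈ᴳ H = ∀ v w → Adj G v w ⇔ Adj H v w

  -- E(G) is the intersection of the E(H j); for d = 0 this says that all
  -- distinct vertices of G are adjacent.
  IsIntersection : Graph V → ∀ {d} → (Fin d → Graph V) → Set
  IsIntersection G H = ∀ v w → v ≢ w → Adj G v w ⇔ (∀ j → Adj (H j) v w)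

record Interval : Set where
  field
    lower upper : ℝ
    lower≤upper : lower ≤ᴿ upper

open Interval public

infix 4 _∈ᴵ_

_∈ᴵ_ : ℝ → Interval → Set
x ∈ᴵ I = lower I ≤ᴿ x × x ≤ᴿ upper I

module _ {V : FiniteSet} where

  intersectionGraph : (Carrier V → Interval) → Graph V
  intersectionGraph I = record
    { Adj    = λ v w → v ≢ w × ∃[ x ] (x ∈ᴵ I v × x ∈ᴵ I w)
    ; symm   = λ (v≢w , x , x∈Iv , x∈Iw) → v≢w ∘ sym , x , x∈Iw , x∈Iv
    ; irrefl = λ (v≢v , _) → v≢v refl
    }

  IsIntervalGraph : Graph V → Set
  IsIntervalGraph G = ∃[ I ] G ≈ᴳ intersectionGraph I

  thresholdGraph : (Carrier V → ℝ) → ℝ → Graph V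
  thresholdGraph α S = record
    { Adj    = λ v w → v ≢ w × S ≤ᴿ α v +ᴿ α w
    ; symm   = λ {v} {w} (v≢w , S≤) → v≢w ∘ sym , +ᴿ-comm-≥ {S} (α v) (α w) S≤
    ; irrefl = λ (v≢v , _) → v≢v refl
    }

  IsThresholdGraph : Graph V → Set
  IsThresholdGraph G = ∃[ α ] ∃[ S ] G ≈ᴳ thresholdGraph α S

IsMinimum : ∀ {ℓ} → Pred ℕ ℓ → Pred ℕ ℓ
IsMinimum P d = P d × (∀ k → P k → d ℕ.≤ k)

module _ {V : FiniteSet} where

  IsIntersectionOf : (Graph V → Set) → Graph V → ℕ → Set₁
  IsIntersectionOf P G d =
    Σ[ H ∈ (Fin d → Graph V) ] (∀ j → P (H j)) × IsIntersection G H

  -- Constructively, the minimum need not be computable from G, so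
  -- box(G) = d and dim_TH(G) = d are expressed as relations.
  HasBoxicity : Graph V → ℕ → Set₁
  HasBoxicity G = IsMinimum (IsIntersectionOf IsIntervalGraph G)

  HasThresholdDimension : Graph V → ℕ → Set₁
  HasThresholdDimension G = IsMinimum (IsIntersectionOf IsThresholdGraph G)

IsVertex : ∀ {n} → Subset n → Set
IsVertex p = Nonempty p × p ⊂ ⊤

-- The proof of IsVertex is irrelevant, so that each subset gives at most
-- one vertex.
Vertex : ℕ → Set
Vertex n = [ p ∈ Subset n ∣ IsVertex p ]

private
  subsets : ∀ n → List (Subset n)
  subsets zero    = [] ∷ []
  subsets (suc n) = map (inside ∷_) (subsets n)
                 ++ map (outside ∷_) (subsets n)

  ∈-subsets : ∀ {n} (p : Subset n) → p ∈ subsets n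
  ∈-subsets []              = here refl
  ∈-subsets (inside ∷ p)    = ∈-++⁺ˡ (∈-map⁺ _ (∈-subsets p))
  ∈-subsets {suc n} (outside ∷ p) =
    ∈-++⁺ʳ (map (inside ∷_) (subsets n)) (∈-map⁺ _ (∈-subsets p))

  isVertex? : ∀ {n} (p : Subset n) → Dec (IsVertex p)
  isVertex? p = nonempty? p ×-dec (p ⊂? ⊤)

  toVertex : ∀ {n} (p : Subset n) → Dec (IsVertex p) → List (Vertex n)
  toVertex p (yes v) = (p , irr v) ∷ []
  toVertex p (no _)  = []

  ∈-toVertex : ∀ {n} (p : Subset n) .(v : IsVertex p) (v? : Dec (IsVertex p)) →
               (p , irr v) ∈ toVertex p v?
  ∈-toVertex p v (yes _) = here refl
  ∈-toVertex p v (no ¬v) = ⊥-elim-irr (¬v v)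

vertexSet : ℕ → FiniteSet
vertexSet n = record
  { Carrier  = Vertex n
  ; _≟_      = ≟-value (≡-dec _≟ᵇ_)
  ; elements = concatMap (λ p → toVertex p (isVertex? p)) (subsets n)
  ; complete = λ (p , irr v) →
      ∈-concatMap⁺ _ (lose (∈-subsets p) (∈-toVertex p v (isVertex? p)))
  }

D : ∀ n → Graph (vertexSet n)
D n = record
  { Adj    = λ v w → Empty (value v ∩ value w)
  ; symm   = λ {v} {w} → subst Empty (∩-comm (value v) (value w))
  ; irrefl = λ { {p , irr v} e →
      ⊥-elim-irr (subst Empty (∩-idem p) e (proj₁ v)) }
  }

{-# OPTIONS --safe #-}

-- Upper bound: in the j-th threshold graph a set pays 2 for missing j and 1 for
-- missing a fixed element 0, and two sets are joined when they pay at least 3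
-- together. Disjoint sets always are; two sets that share j are not. If p ≠ q
-- share 0, one of them contains some j ≠ 0, and the j-th graph separates them.
--
-- Lower bound: {i, j} and {i} are not adjacent, so one of the graphs separates
-- them; write i ⟶ j. In an interval graph containing D n, separated pairs on
-- the same side cross as in an interval order, which forces any two edges
-- i ⟶ j to meet, every j to have at most one incoming edge per side, and
-- opposite edges to use the same side. Hence each graph has at most
-- max (n + 1, 5) of these edges, the extremal cases being a star and a triangle.
-- Since all n (n − 1) edges must occur, at least n − 1 graphs are needed.
module Submission where

open import Defs
open import Algebra.Properties.CommutativeSemigroup using (interchange)
open import Data.Bool.Base using (Bool; true; false; if_then_else_)
open import Data.Empty using (⊥; ⊥-elim; ⊥-elim-irr)
open import Data.Fin.Base using (Fin; zero; suc; toℕ)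
open import Data.Fin.Properties using (_≟_; any?; sequence; toℕ<n; toℕ-injective)
open import Data.Fin.Subset using (Subset; inside; outside; ⊤; ⁅_⁆; _∪_; _∩_; Empty; _∈_)
import Data.Fin.Subset as Subset
open import Data.Fin.Subset.Properties
  using (∈⊤; ∉⊥; x∈⁅x⁆; x∈⁅y⁆⇒x≡y; x∈p∪q⁺; x∈p∪q⁻; x∈p∩q⁺; x∈p∩q⁻; ∪-comm; Empty-unique)
open import Data.Irrelevant using () renaming ([_] to irr)
open import Data.List.Base using (length; lookup)
open import Data.List.Relation.Unary.Any using (index)
open import Data.List.Relation.Unary.Any.Properties using (lookup-index)
open import Data.Nat.Base using (ℕ; zero; suc; _+_; _*_; _∸_; _⊔_; _≤_; _<_; z≤n; s≤s; s≤s⁻¹)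
import Data.Nat.Properties as ℕ
open import Data.Nat.Solver using () renaming (module +-*-Solver to ℕ-Solver)
open import Data.Product.Base using (∃-syntax; _×_; _,_; proj₁; proj₂)
open import Data.Rational.Base as ℚ using (ℚ; 0ℚ; 1ℚ; ½; ∣_∣)
import Data.Rational.Properties as ℚ
open import Data.Rational.Solver using () renaming (module +-*-Solver to ℚ-Solver)
open import Data.Refinement using (_,_; value; value-injective)
open import Data.Sum.Base as Sum using (_⊎_; inj₁; inj₂; [_,_]′)
open import Data.Vec.Base as Vec using ([]; _∷_; here; there)
open import Data.Vec.Properties using ([]=⇒lookup; lookup⇒[]=)
open import Effect.Monad using (RawMonad)
open import Function.Base using (_∘_)
open import Function.Bundles using (_⇔_; mk⇔; module Equivalence)
open import Relation.Binary.PropositionalEquality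
open import Relation.Nullary.Decidable.Core
  using (Dec; yes; no; _×-dec_; _⊎-dec_; ¬?; decidable-stable; ¬¬-excluded-middle)
open import Relation.Nullary.Negation using (¬¬-Monad)
open import Relation.Nullary.Negation.Core using (¬_; contradiction)

open import Algebra.Properties.CommutativeMonoid.Sum ℕ.+-0-commutativeMonoid
  using (sum; sum-syntax; sum-cong-≗; sum-replicate-zero; ∑-distrib-+; ∑-comm)
open Equivalence using (to; from)

-- Finite sums and counting

∑-mono-≤ : ∀ {n} {f g : Fin n → ℕ} → (∀ i → f i ≤ g i) → sum f ≤ sum g
∑-mono-≤ {zero}  f≤g = z≤n
∑-mono-≤ {suc n} f≤g = ℕ.+-mono-≤ (f≤g zero) (∑-mono-≤ (f≤g ∘ suc))

∑-const : ∀ n c → ∑[ i < n ] c ≡ n * c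
∑-const zero    c = refl
∑-const (suc n) c = cong (c +_) (∑-const n c)

#_ : ∀ {A : Set} → Dec A → ℕ
# yes _ = 1
# no  _ = 0

#≡1 : ∀ {A : Set} (a? : Dec A) → A → # a? ≡ 1
#≡1 (yes _) _ = refl
#≡1 (no ¬a) a = contradiction a ¬a

#-≤ : ∀ {A : Set} (a? : Dec A) {m} → (A → 1 ≤ m) → # a? ≤ m
#-≤ (yes a) 1≤m = 1≤m a
#-≤ (no _)  _   = z≤n

f≤∑f : ∀ {n} (f : Fin n → ℕ) i → f i ≤ sum f
f≤∑f f zero    = ℕ.m≤m+n _ _
f≤∑f f (suc i) = ℕ.≤-trans (f≤∑f (f ∘ suc) i) (ℕ.m≤n+m _ _)

δ : ∀ {n} → Fin n → Fin n → ℕ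
δ x i = # (i ≟ x)

∑-δ : ∀ {n} (x : Fin n) → sum (δ x) ≡ 1
∑-δ {suc n} zero = cong suc (sum-replicate-zero n)
∑-δ (suc x) = trans (sum-cong-≗ shift) (∑-δ x)
  where
  shift : ∀ i → # (suc i ≟ suc x) ≡ # (i ≟ x)
  shift i with i ≟ x
  ... | yes _ = refl
  ... | no _ = refl

count-≤1 : ∀ {n} {P : Fin n → Set} (P? : ∀ i → Dec (P i)) →
           (∀ {i j} → P i → P j → i ≡ j) → ∑[ i < n ] # (P? i) ≤ 1
count-≤1 {n} P? unique with any? P?
... | yes (x , px) = ℕ.≤-trans
  (∑-mono-≤ λ i → #-≤ (P? i) λ pi → ℕ.≤-reflexive (sym (#≡1 (i ≟ x) (unique pi px))))
  (ℕ.≤-reflexive (∑-δ x))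
... | no ¬p = ℕ.≤-trans
  (∑-mono-≤ λ i → #-≤ (P? i) λ pi → contradiction (i , pi) ¬p)
  (ℕ.≤-trans (ℕ.≤-reflexive (sum-replicate-zero n)) z≤n)

-- Separation events

infix 4 _∈ₚ_

_∈ₚ_ : ∀ {n} → Fin n → Fin n × Fin n → Set
x ∈ₚ (i , j) = x ≡ i ⊎ x ≡ j

Meet : ∀ {n} → Fin n × Fin n → Fin n × Fin n → Set
Meet p q = ∃[ x ] x ∈ₚ p × x ∈ₚ q

-- An event i ⟶ j on a side says that this side of an interval graph
-- separates {i, j} from {i}.
record Events (n : ℕ) : Set₁ where
  field
    Event     : Fin 2 → Fin n → Fin n → Set
    loopless  : ∀ {b i j} → Event b i j → i ≢ j
    meet      : ∀ {b c i j k l} → Event b i j → Event c k l → Meet (i , j) (k , l)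
    unique    : ∀ {b i j k} → Event b i k → Event b j k → i ≡ j
    same-side : ∀ {b c i j} → Event b i j → Event c j i → b ≡ c

  infix 4 _⟶_

  _⟶_ : Fin n → Fin n → Set
  i ⟶ j = ∃[ b ] Event b i j

  two-sides : {a b c : Fin 2} → a ≢ b → a ≢ c → b ≢ c → ∀ {A : Set} → A
  two-sides {zero}     {zero}     {_}        a≢b _   _   = contradiction refl a≢b
  two-sides {zero}     {suc zero} {zero}     _   a≢c _   = contradiction refl a≢c
  two-sides {zero}     {suc zero} {suc zero} _   _   b≢c = contradiction refl b≢c
  two-sides {suc zero} {suc zero} {_}        a≢b _   _   = contradiction refl a≢b
  two-sides {suc zero} {zero}     {suc zero} _   a≢c _   = contradiction refl a≢c
  two-sides {suc zero} {zero}     {zero}     _   _   b≢c = contradiction refl b≢c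

  distinct-sides : ∀ {b c i j k} → i ≢ j → Event b i k → Event c j k → b ≢ c
  distinct-sides i≢j e f refl = i≢j (unique e f)

  -- Opposite events lie on one side, and two events with the same head
  -- on different sides, so the three edges would need three sides.
  no-full-triangle : ∀ {x y z} → y ⟶ x → z ⟶ x → x ⟶ y → z ⟶ y → x ⟶ z → y ⟶ z →
                     ∀ {A : Set} → A
  no-full-triangle {x} {y} {z} (a , yx) (b , zx) (_ , xy) (c , zy) (_ , xz) (_ , yz)
    with refl ← same-side yx xy | refl ← same-side zx xz | refl ← same-side zy yz
    = two-sides (distinct-sides (loopless yz) yx zx)
                (distinct-sides (loopless xz) xy zy)
                (distinct-sides (loopless xy) xz yz)

  -- If `y` were neither `p` nor `q`, an event `u ⟶ y` could meet both `p ⟶ x` and `q ⟶ x` only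
  -- through `u`, forcing `u` to be `x`; then `r` and `s` would coincide.
  head∈tails : ∀ {x y p q r s} → x ≢ y →
             p ⟶ x → q ⟶ x → p ≢ q → r ⟶ y → s ⟶ y → r ≢ s → y ∈ₚ (p , q)
  head∈tails {x} {y} {p} {q} {r} {s} x≢y (_ , px) (_ , qx) p≢q (_ , ry) (_ , sy) r≢s
    with y ≟ p | y ≟ q
  ... | yes y≡p | _       = inj₁ y≡p
  ... | no _    | yes y≡q = inj₂ y≡q
  ... | no y≢p  | no y≢q  = contradiction (trans (tail≡x ry) (sym (tail≡x sy))) r≢s
    where
    tail : ∀ {b c t u} → y ≢ t → Event b t x → Event c u y → u ≡ t ⊎ u ≡ x
    tail y≢t e f with meet e f
    ... | _ , inj₁ refl , inj₁ refl = inj₁ refl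
    ... | _ , inj₁ refl , inj₂ refl = contradiction refl y≢t
    ... | _ , inj₂ refl , inj₁ refl = inj₂ refl
    ... | _ , inj₂ refl , inj₂ refl = contradiction refl x≢y

    tail≡x : ∀ {c u} → Event c u y → u ≡ x
    tail≡x f with tail y≢p px f | tail y≢q qx f
    ... | inj₂ u≡x | _        = u≡x
    ... | inj₁ _   | inj₂ u≡x = u≡x
    ... | inj₁ u≡p | inj₁ u≡q = contradiction (trans (sym u≡p) u≡q) p≢q

  Crowded : Fin n → Set
  Crowded x = ∃[ p ] ∃[ q ] p ≢ q × p ⟶ x × q ⟶ x

  second-tail : ∀ {x y} → x ≢ y → Crowded x → Crowded y →
                y ⟶ x × ∃[ q ] q ≢ y × q ⟶ x
  second-tail x≢y (p , q , p≢q , px , qx) (_ , _ , r≢s , ry , sy)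
    with head∈tails x≢y px qx p≢q ry sy r≢s
  ... | inj₁ refl = px , q , p≢q ∘ sym , qx
  ... | inj₂ refl = qx , p , p≢q , px

  -- `second-tail` in both directions gives `y ⟶ x` and `x ⟶ y` together with further events `q ⟶ x`
  -- and `s ⟶ y`; these two can meet only if `q` equals `s`.
  triangle : ∀ {x y} → x ≢ y → Crowded x → Crowded y →
             ∃[ q ] q ⟶ x × q ⟶ y × x ⟶ y × y ⟶ x
  triangle {x} {y} x≢y cx cy
    with yx , q , q≢y , qx ← second-tail x≢y cx cy
       | xy , s , s≢x , sy ← second-tail (x≢y ∘ sym) cy cx
    with meet (proj₂ qx) (proj₂ sy)
  ... | _ , inj₁ refl , inj₁ refl = q , qx , sy , xy , yx
  ... | _ , inj₁ refl , inj₂ refl = contradiction refl q≢y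
  ... | _ , inj₂ refl , inj₁ refl = contradiction refl s≢x
  ... | _ , inj₂ refl , inj₂ refl = contradiction refl x≢y

  module Triangle {x y q} (qx : q ⟶ x) (qy : q ⟶ y) (xy : x ⟶ y) (yx : y ⟶ x) where

    tail∈xy : ∀ {u v} → v ≢ x → v ≢ y → u ⟶ v → u ∈ₚ (x , y)
    tail∈xy v≢x v≢y (_ , uv) with meet (proj₂ xy) uv
    ... | _ , inj₁ refl , inj₁ refl = inj₁ refl
    ... | _ , inj₁ refl , inj₂ refl = contradiction refl v≢x
    ... | _ , inj₂ refl , inj₁ refl = inj₂ refl
    ... | _ , inj₂ refl , inj₂ refl = contradiction refl v≢y

    -- The tail is `x` or `y`. From `x`, the event has to meet `q ⟶ y`, which only its head can do,
    -- at `q`; from `y`, the same holds with `q ⟶ x`.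
    head : ∀ {u v} → u ⟶ v → v ≢ x → v ≢ y → v ≡ q
    head {u} {v} uv v≢x v≢y with tail∈xy v≢x v≢y uv
    ... | inj₁ refl with meet (proj₂ qy) (proj₂ uv)
    ...   | _ , inj₁ refl , inj₁ refl = contradiction refl (loopless (proj₂ qx))
    ...   | _ , inj₁ refl , inj₂ refl = refl
    ...   | _ , inj₂ refl , inj₁ refl = contradiction refl (loopless (proj₂ xy))
    ...   | _ , inj₂ refl , inj₂ refl = contradiction refl v≢y
    head {u} {v} uv v≢x v≢y | inj₂ refl with meet (proj₂ qx) (proj₂ uv)
    ...   | _ , inj₁ refl , inj₁ refl = contradiction refl (loopless (proj₂ qy))
    ...   | _ , inj₁ refl , inj₂ refl = refl
    ...   | _ , inj₂ refl , inj₁ refl = contradiction refl (loopless (proj₂ yx))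
    ...   | _ , inj₂ refl , inj₂ refl = contradiction refl v≢x

    -- The only possible tails are `x` and `y`; if both occurred, all six edges on `x`, `y`, `q`
    -- would be present.
    apex-unique : ∀ {u v} → u ⟶ q → v ⟶ q → u ≡ v
    apex-unique uq vq
      with tail∈xy (loopless (proj₂ qx)) (loopless (proj₂ qy)) uq
         | tail∈xy (loopless (proj₂ qx)) (loopless (proj₂ qy)) vq
    ... | inj₁ refl | inj₁ refl = refl
    ... | inj₁ refl | inj₂ refl = no-full-triangle yx qx xy qy uq vq
    ... | inj₂ refl | inj₁ refl = no-full-triangle yx qx xy qy vq uq
    ... | inj₂ refl | inj₂ refl = refl

  -- Counting needs decided events. The order on the reals does not decide them, so `n∸1≤` supplies
  -- `event?` under a double negation.
  module Count (event? : ∀ b i j → Dec (Event b i j)) where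

    _⟶?_ : ∀ i j → Dec (i ⟶ j)
    i ⟶? j = any? (λ b → event? b i j)

    crowded? : ∀ x → Dec (Crowded x)
    crowded? x = any? λ p → any? λ q → ¬? (p ≟ q) ×-dec (p ⟶? x ×-dec q ⟶? x)

    indegree : Fin n → ℕ
    indegree j = ∑[ i < n ] # (i ⟶? j)

    indegree≤2 : ∀ j → indegree j ≤ 2
    indegree≤2 j = begin
      ∑[ i < n ] # (i ⟶? j)                 ≤⟨ ∑-mono-≤ (λ i → #-≤ (i ⟶? j) λ (b , e) →
                                                 ℕ.≤-trans (ℕ.≤-reflexive (sym (#≡1 (event? b i j) e)))
                                                           (f≤∑f (λ b → # (event? b i j)) b)) ⟩
      ∑[ i < n ] ∑[ b < 2 ] # (event? b i j) ≡⟨ ∑-comm (λ i b → # (event? b i j)) ⟩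
      ∑[ b < 2 ] ∑[ i < n ] # (event? b i j) ≤⟨ ∑-mono-≤ (λ b → count-≤1 (λ i → event? b i j) unique) ⟩
      2                                      ∎
      where open ℕ.≤-Reasoning

    uncrowded : ∀ {j} → ¬ Crowded j → indegree j ≤ 1
    uncrowded {j} ¬c = count-≤1 (_⟶? j) equal
      where
      equal : ∀ {p q} → p ⟶ j → q ⟶ j → p ≡ q
      equal {p} {q} pj qj with p ≟ q
      ... | yes p≡q = p≡q
      ... | no p≢q = contradiction (p , q , p≢q , pj , qj) ¬c

    indegree≡0 : ∀ {j} → (∀ i → ¬ i ⟶ j) → indegree j ≤ 0
    indegree≡0 {j} ¬ij = ℕ.≤-trans
      (∑-mono-≤ λ i → #-≤ (i ⟶? j) λ ij → contradiction ij (¬ij i))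
      (ℕ.≤-reflexive (sum-replicate-zero n))

    -- Heads are confined to `x`, `y` and `q`, with indegrees at most 2, 2 and 1; the doubled `δ`
    -- terms encode the two 2s.
    triangle-≤5 : ∀ {x y q} → q ⟶ x → q ⟶ y → x ⟶ y → y ⟶ x → sum indegree ≤ 5
    triangle-≤5 {x} {y} {q} qx qy xy yx = begin
      sum indegree                                  ≤⟨ ∑-mono-≤ bound ⟩
      ∑[ i < n ] ((δ x i + δ x i) + (δ y i + δ y i) + δ q i)
        ≡⟨ ∑-distrib-+ (λ i → (δ x i + δ x i) + (δ y i + δ y i)) (δ q) ⟩
      ∑[ i < n ] ((δ x i + δ x i) + (δ y i + δ y i)) + sum (δ q)
        ≡⟨ cong₂ _+_ (∑-distrib-+ (λ i → δ x i + δ x i) (λ i → δ y i + δ y i)) (∑-δ q) ⟩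
      ∑[ i < n ] (δ x i + δ x i) + ∑[ i < n ] (δ y i + δ y i) + 1
        ≡⟨ cong (_+ 1) (cong₂ _+_ (double x) (double y)) ⟩
      5                                             ∎
      where
      open ℕ.≤-Reasoning
      open Triangle qx qy xy yx

      double : ∀ z → ∑[ i < n ] (δ z i + δ z i) ≡ 2
      double z = trans (∑-distrib-+ (δ z) (δ z)) (cong₂ _+_ (∑-δ z) (∑-δ z))

      bound : ∀ i → indegree i ≤ (δ x i + δ x i) + (δ y i + δ y i) + δ q i
      bound i with i ≟ x | i ≟ y | i ≟ q
      ... | yes _ | _     | _        = ℕ.≤-trans (indegree≤2 i) (s≤s (s≤s z≤n))
      ... | no _  | yes _ | _        = ℕ.≤-trans (indegree≤2 i) (s≤s (s≤s z≤n))
      ... | no _  | no _  | yes refl = count-≤1 (_⟶? i) apex-unique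
      ... | no i≢x | no i≢y | no i≢q = indegree≡0 λ u ui → i≢q (head ui i≢x i≢y)

    star-≤n+1 : ∀ x → (∀ y → y ≢ x → ¬ Crowded y) → sum indegree ≤ n + 1
    star-≤n+1 x ¬c = begin
      sum indegree          ≤⟨ ∑-mono-≤ bound ⟩
      ∑[ i < n ] (1 + δ x i) ≡⟨ ∑-distrib-+ (λ _ → 1) (δ x) ⟩
      ∑[ i < n ] 1 + sum (δ x) ≡⟨ cong₂ _+_ (trans (∑-const n 1) (ℕ.*-identityʳ n)) (∑-δ x) ⟩
      n + 1 ∎
      where
      open ℕ.≤-Reasoning
      bound : ∀ i → indegree i ≤ 1 + δ x i
      bound i with i ≟ x
      ... | yes _ = indegree≤2 i
      ... | no i≢x = uncrowded (¬c i i≢x)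

    sum-indegree : sum indegree ≤ (n + 1) ⊔ 5
    sum-indegree with any? crowded?
    ... | no ¬∃c = begin
      sum indegree   ≤⟨ ∑-mono-≤ (λ i → uncrowded (¬∃c ∘ (i ,_))) ⟩
      ∑[ i < n ] 1   ≡⟨ trans (∑-const n 1) (ℕ.*-identityʳ n) ⟩
      n              ≤⟨ ℕ.m≤m+n n 1 ⟩
      n + 1          ≤⟨ ℕ.m≤m⊔n (n + 1) 5 ⟩
      (n + 1) ⊔ 5    ∎
      where open ℕ.≤-Reasoning
    ... | yes (x , cx) with any? (λ y → ¬? (y ≟ x) ×-dec crowded? y)
    ...   | no ¬∃y = ℕ.m≤n⇒m≤n⊔o 5 (star-≤n+1 x λ y y≢x cy → ¬∃y (y , y≢x , cy))
    ...   | yes (y , y≢x , cy) with q , qx , qy , xy , yx ← triangle (y≢x ∘ sym) cx cy =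
      ℕ.m≤n⇒m≤o⊔n (n + 1) (triangle-≤5 qx qy xy yx)

-- Counting events over all graphs

module _ {n k} (S : Fin k → Events n) where

  open module E h = Events (S h) using (Event; _⟶_)

  -- Double counting of ordered pairs: the `n` diagonal ones are absorbed by `δ`, every other one by
  -- some graph that has it as an edge.
  covering-count : (∀ h b i j → Dec (Event h b i j)) →
                   (∀ {i j} → i ≢ j → ∃[ h ] _⟶_ h i j) →
                   n * n ≤ n + k * ((n + 1) ⊔ 5)
  covering-count event? cover = begin
    n * n
      ≡⟨ ∑-const n n ⟨
    ∑[ j < n ] n
      ≡⟨ sum-cong-≗ {n} (λ _ → trans (∑-const n 1) (ℕ.*-identityʳ n)) ⟨
    ∑[ j < n ] ∑[ i < n ] 1
      ≤⟨ ∑-mono-≤ (λ j → ∑-mono-≤ λ i → covered i j) ⟩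
    ∑[ j < n ] ∑[ i < n ] (δ j i + ∑[ h < k ] # (arrow? h i j))
      ≡⟨ sum-cong-≗ (λ j → trans (∑-distrib-+ (δ j) λ i → ∑[ h < k ] # (arrow? h i j))
                                 (cong₂ _+_ (∑-δ j) (∑-comm λ i h → # (arrow? h i j)))) ⟩
    ∑[ j < n ] (1 + ∑[ h < k ] indegree h j)
      ≡⟨ ∑-distrib-+ (λ _ → 1) (λ j → ∑[ h < k ] indegree h j) ⟩
    ∑[ j < n ] 1 + ∑[ j < n ] ∑[ h < k ] indegree h j
      ≡⟨ cong₂ _+_ (trans (∑-const n 1) (ℕ.*-identityʳ n)) (∑-comm λ j h → indegree h j) ⟩
    n + ∑[ h < k ] sum (indegree h)
      ≤⟨ ℕ.+-monoʳ-≤ n (∑-mono-≤ λ h → C.sum-indegree h) ⟩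
    n + ∑[ h < k ] ((n + 1) ⊔ 5)
      ≡⟨ cong (n +_) (∑-const k _) ⟩
    n + k * ((n + 1) ⊔ 5) ∎
    where
    open ℕ.≤-Reasoning
    module C h = Events.Count (S h) (event? h)
    open C using (indegree) renaming (_⟶?_ to arrow?)

    covered : ∀ i j → 1 ≤ δ j i + ∑[ h < k ] # (arrow? h i j)
    covered i j with i ≟ j
    ... | yes _ = s≤s z≤n
    ... | no i≢j with h , ij ← cover i≢j =
      ℕ.≤-trans (ℕ.≤-reflexive (sym (#≡1 (arrow? h i j) ij)))
                (f≤∑f (λ h → # (arrow? h i j)) h)

count⇒n∸1≤k : ∀ {n k} → 3 ≤ n → n * n ≤ n + k * ((n + 1) ⊔ 5) → n ∸ 1 ≤ k
count⇒n∸1≤k {suc (suc (suc m))} {k} (s≤s (s≤s (s≤s _))) count = ℕ.≮⇒≥ λ k<n∸1 →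
  ℕ.<⇒≱ (few k (s≤s⁻¹ k<n∸1)) count
  where
  open ℕ-Solver
  open ℕ.≤-Reasoning

  -- With `n = 3 + m` and at most `n - 2` graphs, the bound falls short of `n * n` by at least 2 if
  -- the maximum is `n + 1`, and by at least `1 + m * m` if it is 5.
  square₁ : ∀ m → 2 + (3 + m + (1 + m) * (3 + m + 1)) ≡ (3 + m) * (3 + m)
  square₁ = solve 1 (λ m → con 2 :+ (con 3 :+ m :+ (con 1 :+ m) :* (con 3 :+ m :+ con 1))
                           := (con 3 :+ m) :* (con 3 :+ m)) refl

  square₂ : ∀ m → 1 + m * m + (3 + m + (1 + m) * 5) ≡ (3 + m) * (3 + m)
  square₂ = solve 1 (λ m → con 1 :+ m :* m :+ (con 3 :+ m :+ (con 1 :+ m) :* con 5)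
                           := (con 3 :+ m) :* (con 3 :+ m)) refl

  few : ∀ k → k ≤ 1 + m → 3 + m + k * ((3 + m + 1) ⊔ 5) < (3 + m) * (3 + m)
  few k k≤1+m with ℕ.⊔-sel (3 + m + 1) 5
  ... | inj₁ eq = begin-strict
    3 + m + k * ((3 + m + 1) ⊔ 5)       ≡⟨ cong (λ t → 3 + m + k * t) eq ⟩
    3 + m + k * (3 + m + 1)             ≤⟨ ℕ.+-monoʳ-≤ (3 + m) (ℕ.*-monoˡ-≤ _ k≤1+m) ⟩
    3 + m + (1 + m) * (3 + m + 1)       <⟨ ℕ.m<n+m _ {2} (s≤s z≤n) ⟩
    2 + (3 + m + (1 + m) * (3 + m + 1)) ≡⟨ square₁ m ⟩
    (3 + m) * (3 + m)                   ∎
  ... | inj₂ eq = begin-strict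
    3 + m + k * ((3 + m + 1) ⊔ 5)       ≡⟨ cong (λ t → 3 + m + k * t) eq ⟩
    3 + m + k * 5                       ≤⟨ ℕ.+-monoʳ-≤ (3 + m) (ℕ.*-monoˡ-≤ 5 k≤1+m) ⟩
    3 + m + (1 + m) * 5                 <⟨ ℕ.m<n+m _ (s≤s z≤n) ⟩
    1 + m * m + (3 + m + (1 + m) * 5)   ≡⟨ square₂ m ⟩
    (3 + m) * (3 + m)                   ∎

-- Real numbers

0<½* : ∀ {ε} → 0ℚ ℚ.< ε → 0ℚ ℚ.< ½ ℚ.* ε
0<½* {ε} 0<ε = subst (ℚ._< ½ ℚ.* ε) (ℚ.*-zeroʳ ½) (ℚ.*-monoʳ-<-pos ½ 0<ε)

p<p+ε : ∀ p {ε} → 0ℚ ℚ.< ε → p ℚ.< p ℚ.+ ε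
p<p+ε p {ε} 0<ε = subst (ℚ._< p ℚ.+ ε) (ℚ.+-identityʳ p) (ℚ.+-monoʳ-< p 0<ε)

p≤∣p∣ : ∀ p → p ℚ.≤ ∣ p ∣
p≤∣p∣ p with ℚ.≤-total 0ℚ p
... | inj₁ 0≤p = ℚ.≤-reflexive (sym (ℚ.0≤p⇒∣p∣≡p 0≤p))
... | inj₂ p≤0 = ℚ.≤-trans p≤0 (ℚ.0≤∣p∣ p)

∣p-q∣<ε⇒p<q+ε : ∀ p q {ε} → ∣ p ℚ.- q ∣ ℚ.< ε → p ℚ.< q ℚ.+ ε
∣p-q∣<ε⇒p<q+ε p q {ε} close = begin-strict
  p                ≡⟨ solve 2 (λ p q → p := q :+ (p :- q)) refl p q ⟩
  q ℚ.+ (p ℚ.- q)  <⟨ ℚ.+-monoʳ-< q (ℚ.≤-<-trans (p≤∣p∣ (p ℚ.- q)) close) ⟩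
  q ℚ.+ ε          ∎
  where
  open ℚ.≤-Reasoning
  open ℚ-Solver

≤ᴿ-refl : ∀ x → x ≤ᴿ x
≤ᴿ-refl x ε 0<ε = 0 , λ n _ → p<p+ε (seq x n) 0<ε

≤ᴿ-trans : ∀ x y z → x ≤ᴿ y → y ≤ᴿ z → x ≤ᴿ z
≤ᴿ-trans x y z x≤y y≤z ε 0<ε with x≤y (½ ℚ.* ε) (0<½* 0<ε) | y≤z (½ ℚ.* ε) (0<½* 0<ε)
... | M , x<y | N , y<z = M ⊔ N , λ n M⊔N≤n → begin-strict
  seq x n                                <⟨ x<y n (ℕ.m⊔n≤o⇒m≤o M N M⊔N≤n) ⟩
  seq y n ℚ.+ ½ ℚ.* ε                    <⟨ ℚ.+-monoˡ-< (½ ℚ.* ε) (y<z n (ℕ.m⊔n≤o⇒n≤o M N M⊔N≤n)) ⟩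
  (seq z n ℚ.+ ½ ℚ.* ε) ℚ.+ ½ ℚ.* ε      ≡⟨ solve 2 (λ z ε → (z :+ con ½ :* ε) :+ con ½ :* ε := z :+ ε) refl (seq z n) ε ⟩
  seq z n ℚ.+ ε                          ∎
  where
  open ℚ.≤-Reasoning
  open ℚ-Solver

-- Compare x and y at a late index N: if x is not clearly below y + ε
-- there, then y stays below x from N on.
≰ᴿ⇒≥ᴿ : ∀ x y → ¬ y ≤ᴿ x → x ≤ᴿ y
≰ᴿ⇒≥ᴿ x y y≰x ε 0<ε = N , below
  where
  open ℚ.≤-Reasoning
  open ℚ-Solver
  -- A quarter of `ε`: the chain in the `yes` branch of `below` spends `η` four times.
  η = ½ ℚ.* (½ ℚ.* ε)
  0<η = 0<½* (0<½* 0<ε)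
  M = proj₁ (cauchy x η 0<η)
  M′ = proj₁ (cauchy y η 0<η)
  N = M ⊔ M′
  close-x : ∀ m n → N ≤ m → N ≤ n → seq x m ℚ.< seq x n ℚ.+ η
  close-x m n N≤m N≤n = ∣p-q∣<ε⇒p<q+ε (seq x m) (seq x n) (proj₂ (cauchy x η 0<η) m n
    (ℕ.m⊔n≤o⇒m≤o M M′ N≤m) (ℕ.m⊔n≤o⇒m≤o M M′ N≤n))
  close-y : ∀ m n → N ≤ m → N ≤ n → seq y m ℚ.< seq y n ℚ.+ η
  close-y m n N≤m N≤n = ∣p-q∣<ε⇒p<q+ε (seq y m) (seq y n) (proj₂ (cauchy y η 0<η) m n
    (ℕ.m⊔n≤o⇒n≤o M M′ N≤m) (ℕ.m⊔n≤o⇒n≤o M M′ N≤n))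

  xN = seq x N
  yN = seq y N

  below : ∀ n → N ≤ n → seq x n ℚ.< seq y n ℚ.+ ε
  -- Only rationals at the fixed index `N` are compared, so the case split is decidable.
  below n N≤n with xN ℚ.- η ℚ.<? yN ℚ.+ η
  ... | yes xN-η<yN+η = begin-strict
    seq x n                     <⟨ close-x n N N≤n ℕ.≤-refl ⟩
    xN ℚ.+ η                    ≡⟨ solve 2 (λ x η → x :+ η := (x :- η) :+ (η :+ η)) refl xN η ⟩
    (xN ℚ.- η) ℚ.+ (η ℚ.+ η)    <⟨ ℚ.+-monoˡ-< (η ℚ.+ η) xN-η<yN+η ⟩
    (yN ℚ.+ η) ℚ.+ (η ℚ.+ η)    <⟨ ℚ.+-monoˡ-< (η ℚ.+ η) (ℚ.+-monoˡ-< η (close-y N n ℕ.≤-refl N≤n)) ⟩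
    ((seq y n ℚ.+ η) ℚ.+ η) ℚ.+ (η ℚ.+ η)
      ≡⟨ solve 2 (λ y ε → let η = con ½ :* (con ½ :* ε) in
                 ((y :+ η) :+ η) :+ (η :+ η) := y :+ ε) refl (seq y n) ε ⟩
    seq y n ℚ.+ ε               ∎
  ... | no xN-η≮yN+η = contradiction y≤x y≰x
    where
    y≤x : y ≤ᴿ x
    y≤x ε′ 0<ε′ = N , λ m N≤m → begin-strict
      seq y m                <⟨ close-y m N N≤m ℕ.≤-refl ⟩
      yN ℚ.+ η               ≤⟨ ℚ.≮⇒≥ xN-η≮yN+η ⟩
      xN ℚ.- η               <⟨ ℚ.+-monoˡ-< (ℚ.- η) (close-x N m ℕ.≤-refl N≤m) ⟩
      (seq x m ℚ.+ η) ℚ.- η  ≡⟨ solve 2 (λ x η → (x :+ η) :- η := x) refl (seq x m) η ⟩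
      seq x m                <⟨ p<p+ε (seq x m) 0<ε′ ⟩
      seq x m ℚ.+ ε′         ∎

+ᴿ-monoʳ-≤ : ∀ x {y z} → y ≤ᴿ z → x +ᴿ y ≤ᴿ x +ᴿ z
+ᴿ-monoʳ-≤ x {y} {z} y≤z ε 0<ε with y≤z ε 0<ε
... | N , y<z = N , λ n N≤n → begin-strict
  seq x n ℚ.+ seq y n            <⟨ ℚ.+-monoʳ-< (seq x n) (y<z n N≤n) ⟩
  seq x n ℚ.+ (seq z n ℚ.+ ε)    ≡⟨ ℚ.+-assoc (seq x n) (seq z n) ε ⟨
  (seq x n ℚ.+ seq z n) ℚ.+ ε    ∎
  where open ℚ.≤-Reasoning

const : ℚ → ℝ
const p = record
  { seq    = λ _ → p
  ; cauchy = λ ε 0<ε → 0 , λ _ _ _ _ →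
      subst (λ t → ∣ t ∣ ℚ.< ε) (sym (ℚ.+-inverseʳ p)) 0<ε
  }

const-mono : ∀ {p q} → p ℚ.≤ q → const p ≤ᴿ const q
const-mono {p} {q} p≤q ε 0<ε = 0 , λ _ _ → ℚ.≤-<-trans p≤q (p<p+ε q 0<ε)

const-cancel : ∀ {p q} → const p ≤ᴿ const q → p ℚ.≤ q
const-cancel {p} {q} p≤q = ℚ.≮⇒≥ λ q<p →
  let N , p<q+ε = p≤q (p ℚ.- q) (subst (ℚ._< p ℚ.- q) (ℚ.+-inverseʳ q) (ℚ.+-monoˡ-< (ℚ.- q) q<p))
  in ℚ.<-irrefl (solve 2 (λ p q → p := q :+ (p :- q)) refl p q) (p<q+ε N ℕ.≤-refl)
  where open ℚ-Solver

fromℕ : ℕ → ℚ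
fromℕ zero    = 0ℚ
fromℕ (suc n) = 1ℚ ℚ.+ fromℕ n

fromℕ-+ : ∀ m n → fromℕ (m + n) ≡ fromℕ m ℚ.+ fromℕ n
fromℕ-+ zero    n = sym (ℚ.+-identityˡ (fromℕ n))
fromℕ-+ (suc m) n = trans (cong (1ℚ ℚ.+_) (fromℕ-+ m n)) (sym (ℚ.+-assoc 1ℚ (fromℕ m) (fromℕ n)))

fromℕ-nonNeg : ∀ n → 0ℚ ℚ.≤ fromℕ n
fromℕ-nonNeg zero    = ℚ.≤-refl
fromℕ-nonNeg (suc n) = ℚ.+-mono-≤ (ℚ.nonNegative⁻¹ 1ℚ) (fromℕ-nonNeg n)

fromℕ-mono : ∀ {m n} → m ≤ n → fromℕ m ℚ.≤ fromℕ n
fromℕ-mono {n = n} z≤n = fromℕ-nonNeg n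
fromℕ-mono (s≤s m≤n)   = ℚ.+-monoʳ-≤ 1ℚ (fromℕ-mono m≤n)

fromℕ-cancel : ∀ {m n} → fromℕ m ℚ.≤ fromℕ n → m ≤ n
fromℕ-cancel {m} {n} m≤n = ℕ.≮⇒≥ λ n<m → ℚ.<-irrefl refl (begin-strict
  fromℕ n          ≡⟨ ℚ.+-identityˡ (fromℕ n) ⟨
  0ℚ ℚ.+ fromℕ n   <⟨ ℚ.+-monoˡ-< (fromℕ n) (ℚ.positive⁻¹ 1ℚ) ⟩
  fromℕ (suc n)    ≤⟨ fromℕ-mono n<m ⟩
  fromℕ m          ≤⟨ m≤n ⟩
  fromℕ n          ∎)
  where open ℚ.≤-Reasoning

natᴿ : ℕ → ℝ
natᴿ n = const (fromℕ n)

natᴿ-mono : ∀ {m n} → m ≤ n → natᴿ m ≤ᴿ natᴿ n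
natᴿ-mono m≤n = const-mono (fromℕ-mono m≤n)

natᴿ-cancel : ∀ {m n} → natᴿ m ≤ᴿ natᴿ n → m ≤ n
natᴿ-cancel = fromℕ-cancel ∘ const-cancel

-- Separations in interval and threshold graphs

-- Finite double-negation shift: finitely many undecided facts about reals may be treated as decided
-- while a stable goal is proved.
¬¬-all : ∀ {n} {P : Fin n → Set} → (∀ i → ¬ ¬ P i) → ¬ ¬ (∀ i → P i)
¬¬-all = sequence (RawMonad.rawApplicative ¬¬-Monad)

-- For an interval graph the two sides say whether v lies to the left or
-- to the right of w. A threshold graph has a single, symmetric side.
record Separation {V : FiniteSet} (H : Graph V) : Set₁ where
  field
    Sep       : Fin 2 → Carrier V → Carrier V → Set
    sep⇒¬adj  : ∀ {b v w} → Sep b v w → ¬ Adj H v w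
    -- For intervals the side cannot be chosen by deciding an order between reals; hence the double
    -- negation.
    separated : ∀ {v w} → v ≢ w → ¬ Adj H v w → ¬ ¬ (∃[ b ] Sep b v w)
    crossing  : ∀ {b v w x y} → Sep b v w → Sep b x y → ¬ Sep b v y → ¬ Sep b x w → ⊥
    opposed   : ∀ {b c v w x y} → b ≢ c → Sep b v w → Sep c x y →
                v ≡ x ⊎ Adj H v x → ¬ Adj H w y

module _ {V : FiniteSet} {H : Graph V} where

  interval⇒separation : IsIntervalGraph H → Separation H
  interval⇒separation (I , H≈I) = record
    { Sep       = Sep
    ; sep⇒¬adj  = λ { {zero}     vw → left⇒¬adj vw
                    ; {suc zero} vw → left⇒¬adj vw ∘ symm H }
    ; separated = λ v≢w ¬vw ¬sep → ¬sep (zero , λ lw≤uv → ¬sep (suc zero , λ lv≤uw →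
                    intersect v≢w lw≤uv lv≤uw ¬vw))
    ; crossing  = λ { {zero}     vw xy ¬vy ¬xw → left-crossing vw xy ¬vy ¬xw
                    ; {suc zero} vw xy ¬vy ¬xw → left-crossing vw xy ¬xw ¬vy }
    ; opposed   = λ
      { {zero}     {zero}     b≢c                → contradiction refl b≢c
      -- Here `v` is left of `w` and `y` is left of `x`. Crossing would put `v` left of `x`,
      -- excluded by `apart`, or `y` left of `w`, excluded by their adjacency.
      ; {zero}     {suc zero} _   vw yx v≡x∨vx wy →
          left-crossing vw yx (apart v≡x∨vx) (λ yw → left⇒¬adj yw (symm H wy))
      ; {suc zero} {zero}     _   wv xy v≡x∨vx wy →
          left-crossing wv xy (λ wy′ → left⇒¬adj wy′ wy) (apart (Sum.map sym (symm H) v≡x∨vx))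
      ; {suc zero} {suc zero} b≢c                → contradiction refl b≢c
      }
    }
    where
    Left : Carrier V → Carrier V → Set
    Left v w = ¬ lower (I w) ≤ᴿ upper (I v)

    Sep : Fin 2 → Carrier V → Carrier V → Set
    Sep zero    v w = Left v w
    Sep (suc _) v w = Left w v

    left⇒¬adj : ∀ {v w} → Left v w → ¬ Adj H v w
    left⇒¬adj {v} {w} vw adj with to (H≈I v w) adj
    ... | _ , x , (_ , x≤uv) , (lw≤x , _) =
      vw (≤ᴿ-trans (lower (I w)) x (upper (I v)) lw≤x x≤uv)

    apart : ∀ {v x} → v ≡ x ⊎ Adj H v x → ¬ Left v x
    apart {v} (inj₁ refl) vv = vv (lower≤upper (I v))
    apart     (inj₂ vx)   vx′ = left⇒¬adj vx′ vx

    -- The larger of the two lower ends is a common point; which one is larger stays undecided.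
    intersect : ∀ {v w} → v ≢ w → lower (I w) ≤ᴿ upper (I v) → lower (I v) ≤ᴿ upper (I w) →
              ¬ ¬ Adj H v w
    intersect {v} {w} v≢w lw≤uv lv≤uw ¬vw = ¬lv≤lw (≰ᴿ⇒≥ᴿ (lower (I v)) (lower (I w)) ¬lw≤lv)
      where
      ¬lv≤lw : ¬ lower (I v) ≤ᴿ lower (I w)
      ¬lv≤lw lv≤lw = ¬vw (from (H≈I v w)
        (v≢w , lower (I w) , (lv≤lw , lw≤uv) , (≤ᴿ-refl (lower (I w)) , lower≤upper (I w))))
      ¬lw≤lv : ¬ lower (I w) ≤ᴿ lower (I v)
      ¬lw≤lv lw≤lv = ¬vw (from (H≈I v w)
        (v≢w , lower (I v) , (≤ᴿ-refl (lower (I v)) , lower≤upper (I v)) , (lw≤lv , lv≤uw)))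

    -- Compare upper ends: whichever of `v` and `x` ends first also lies left of the other one's
    -- partner.
    left-crossing : ∀ {v w x y} → Left v w → Left x y → ¬ Left v y → ¬ Left x w → ⊥
    left-crossing {v} {w} {x} {y} vw xy ¬vy ¬xw = ¬vy λ ly≤uv → ¬xw λ lw≤ux →
      xy (≤ᴿ-trans (lower (I y)) (upper (I v)) (upper (I x)) ly≤uv
        (≰ᴿ⇒≥ᴿ (upper (I v)) (upper (I x)) λ ux≤uv →
          vw (≤ᴿ-trans (lower (I w)) (upper (I x)) (upper (I v)) lw≤ux ux≤uv)))

  threshold⇒separation : IsThresholdGraph H → Separation H
  threshold⇒separation (α , S , H≈T) = record
    { Sep       = λ b v w → b ≡ zero × Below v w
    ; sep⇒¬adj  = λ {_} {v} {w} (_ , vw) adj → vw (proj₂ (to (H≈T v w) adj))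
    ; separated = λ {v} {w} v≢w ¬vw ¬sep →
                    ¬sep (zero , refl , λ S≤ → ¬vw (from (H≈T v w) (v≢w , S≤)))
    ; crossing  = λ (b≡0 , vw) (_ , xy) ¬vy ¬xw →
                    below-crossing vw xy (¬vy ∘ (b≡0 ,_)) (¬xw ∘ (b≡0 ,_))
    ; opposed   = λ b≢c (b≡0 , _) (c≡0 , _) → contradiction (trans b≡0 (sym c≡0)) b≢c
    }
    where
    Below : Carrier V → Carrier V → Set
    Below v w = ¬ S ≤ᴿ α v +ᴿ α w

    -- Compare `α w` and `α y`: the lighter of `w` and `y` stays below `S` with both `v` and `x`.
    below-crossing : ∀ {v w x y} → Below v w → Below x y → ¬ Below v y → ¬ Below x w → ⊥
    below-crossing {v} {w} {x} {y} vw xy ¬vy ¬xw = ¬vy λ S≤vy → ¬xw λ S≤xw →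
      xy (≤ᴿ-trans S (α x +ᴿ α w) (α x +ᴿ α y) S≤xw
        (+ᴿ-monoʳ-≤ (α x) {α w} {α y} (≰ᴿ⇒≥ᴿ (α w) (α y) λ y≤w →
          vw (≤ᴿ-trans S (α v +ᴿ α y) (α v +ᴿ α w) S≤vy
            (+ᴿ-monoʳ-≤ (α v) {α y} {α w} y≤w)))))

third : ∀ {n} → 3 ≤ n → (i j : Fin n) → ∃[ x ] ¬ x ∈ₚ (i , j)
third (s≤s (s≤s (s≤s _))) zero          zero          = suc zero , λ { (inj₁ ()) ; (inj₂ ()) }
third (s≤s (s≤s (s≤s _))) zero          (suc zero)    = suc (suc zero) , λ { (inj₁ ()) ; (inj₂ ()) }
third (s≤s (s≤s (s≤s _))) zero          (suc (suc _)) = suc zero , λ { (inj₁ ()) ; (inj₂ ()) }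
third (s≤s (s≤s (s≤s _))) (suc _)       (suc _)       = zero , λ { (inj₁ ()) ; (inj₂ ()) }
third (s≤s (s≤s (s≤s _))) (suc zero)    zero          = suc (suc zero) , λ { (inj₁ ()) ; (inj₂ ()) }
third (s≤s (s≤s (s≤s _))) (suc (suc _)) zero          = suc zero , λ { (inj₁ ()) ; (inj₂ ()) }

-- The disjointness graph

module LowerBound {n} (3≤n : 3 ≤ n) where

  -- The case `i = j` gives the singletons, so `pair` supplies both vertices of an event.
  pairSet : Fin n → Fin n → Subset n
  pairSet i j = ⁅ i ⁆ ∪ ⁅ j ⁆

  ∈-pairSet⁺ : ∀ {x i j} → x ∈ₚ (i , j) → x ∈ pairSet i j
  ∈-pairSet⁺ {i = i} {j} = x∈p∪q⁺ ∘ Sum.map (λ { refl → x∈⁅x⁆ i }) (λ { refl → x∈⁅x⁆ j })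

  ∈-pairSet⁻ : ∀ {x i j} → x ∈ pairSet i j → x ∈ₚ (i , j)
  ∈-pairSet⁻ {i = i} {j} = Sum.map (x∈⁅y⁆⇒x≡y i) (x∈⁅y⁆⇒x≡y j) ∘ x∈p∪q⁻ ⁅ i ⁆ ⁅ j ⁆

  pair : Fin n → Fin n → Vertex n
  pair i j = pairSet i j , irr
    ( (i , ∈-pairSet⁺ (inj₁ refl))
    , (λ _ → ∈⊤)
    , let x , x∉ij = third 3≤n i j in x , ∈⊤ , x∉ij ∘ ∈-pairSet⁻
    )

  pair-comm : ∀ i j → pair i j ≡ pair j i
  pair-comm i j = value-injective (∪-comm ⁅ i ⁆ ⁅ j ⁆)

  ¬meet⇒adj : ∀ {i j k l} → ¬ Meet (i , j) (k , l) → Adj (D n) (pair i j) (pair k l)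
  ¬meet⇒adj {i} {j} {k} {l} ¬m (x , x∈) with x∈p∩q⁻ (pairSet i j) (pairSet k l) x∈
  ... | x∈ij , x∈kl = ¬m (x , ∈-pairSet⁻ x∈ij , ∈-pairSet⁻ x∈kl)

  meet⇒¬adj : ∀ {i j k l} → Meet (i , j) (k , l) → ¬ Adj (D n) (pair i j) (pair k l)
  meet⇒¬adj (x , x∈ij , x∈kl) adj = adj (x , x∈p∩q⁺ (∈-pairSet⁺ x∈ij , ∈-pairSet⁺ x∈kl))

  infix 4 _∈ₚ?_

  _∈ₚ?_ : ∀ x (p : Fin n × Fin n) → Dec (x ∈ₚ p)
  x ∈ₚ? (i , j) = (x ≟ i) ⊎-dec (x ≟ j)

  meet? : ∀ p q → Dec (Meet {n} p q)
  meet? p q = any? λ x → (x ∈ₚ? p) ×-dec (x ∈ₚ? q)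

  meet-loopˡ : ∀ {i} {p : Fin n × Fin n} → Meet p (i , i) → i ∈ₚ p
  meet-loopˡ (_ , x∈p , inj₁ refl) = x∈p
  meet-loopˡ (_ , x∈p , inj₂ refl) = x∈p

  module _ {H : Graph (vertexSet n)} (S : Separation H)
           (D⊆H : ∀ {v w} → Adj (D n) v w → Adj H v w) where

    open Separation S

    Event : Fin 2 → Fin n → Fin n → Set
    Event b i j = i ≢ j × Sep b (pair i j) (pair i i)

    -- If neither tail lies in the other pair, `pair i j` is disjoint from `pair k k` and `pair k l`
    -- from `pair i i`. Both are then adjacent in `H`, hence not separated, against `crossing`.
    tails : ∀ {b i j k l} → Event b i j → Event b k l → k ∈ₚ (i , j) ⊎ i ∈ₚ (k , l)
    tails {b} {i} {j} {k} {l} (_ , ij) (_ , kl) with k ∈ₚ? (i , j) | i ∈ₚ? (k , l)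
    ... | yes k∈ij | _        = inj₁ k∈ij
    ... | no _     | yes i∈kl = inj₂ i∈kl
    ... | no k∉ij  | no i∉kl  = ⊥-elim (crossing ij kl (¬sep k∉ij) (¬sep i∉kl))
      where
      ¬sep : ∀ {i j k} → ¬ k ∈ₚ (i , j) → ¬ Sep b (pair i j) (pair k k)
      ¬sep k∉ij sep = sep⇒¬adj sep (D⊆H (¬meet⇒adj (k∉ij ∘ meet-loopˡ)))

    singletons-adj : ∀ {i k} → i ≢ k → Adj H (pair i i) (pair k k)
    singletons-adj i≢k = D⊆H (¬meet⇒adj λ m → [ i≢k ∘ sym , i≢k ∘ sym ]′ (meet-loopˡ m))

    events : Events n
    events = record
      { Event     = Event
      ; loopless  = proj₁
      ; meet      = meet
      ; unique    = unique
      ; same-side = same-side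
      }
      where
      -- On one side this follows from `tails`. On opposite sides, disjoint pairs would be adjacent,
      -- and `opposed` would make two distinct singletons non-adjacent.
      meet : ∀ {b c i j k l} → Event b i j → Event c k l → Meet (i , j) (k , l)
      meet {b} {c} {i} {j} {k} {l} e f with b ≟ c | i ≟ k
      ... | _        | yes i≡k  = i , inj₁ refl , inj₁ i≡k
      ... | yes refl | no _     = [ (λ k∈ij → k , k∈ij , inj₁ refl)
                                  , (λ i∈kl → i , inj₁ refl , i∈kl) ]′ (tails e f)
      ... | no b≢c   | no i≢k   with meet? (i , j) (k , l)
      ...   | yes m = m
      ...   | no ¬m = contradiction (singletons-adj i≢k)
                        (opposed b≢c (proj₂ e) (proj₂ f) (inj₂ (D⊆H (¬meet⇒adj ¬m))))

      -- `tails` places one tail in the other pair, and as no event is a loop it is not the common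
      -- head.
      unique : ∀ {b i j k} → Event b i k → Event b j k → i ≡ j
      unique e f with tails e f
      ... | inj₁ (inj₁ j≡i) = sym j≡i
      ... | inj₁ (inj₂ j≡k) = contradiction j≡k (proj₁ f)
      ... | inj₂ (inj₁ i≡j) = i≡j
      ... | inj₂ (inj₂ i≡k) = contradiction i≡k (proj₁ e)

      -- Both events start from the same two-element set, so on opposite sides the equality case of
      -- `opposed` would make disjoint singletons non-adjacent.
      same-side : ∀ {b c i j} → Event b i j → Event c j i → b ≡ c
      same-side {b} {c} {i} {j} (i≢j , ij) (_ , ji) with b ≟ c
      ... | yes b≡c = b≡c
      ... | no b≢c  = contradiction (singletons-adj i≢j)
                        (opposed b≢c ij ji (inj₁ (pair-comm i j)))

  pair≢singleton : ∀ {i j} → i ≢ j → pair i j ≢ pair i i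
  pair≢singleton {i} {j} i≢j eq =
    [ i≢j ∘ sym , i≢j ∘ sym ]′
      (∈-pairSet⁻ (subst (λ v → j ∈ value v) eq (∈-pairSet⁺ (inj₂ refl))))

  n∸1≤ : ∀ {k} (H : Fin k → Graph (vertexSet n)) → (∀ h → Separation (H h)) →
         IsIntersection (D n) H → n ∸ 1 ≤ k
  -- The goal is decidable, hence stable, so all events may be assumed decided.
  n∸1≤ {k} H S D≡∩H = decidable-stable (n ∸ 1 ℕ.≤? k) λ n∸1≰k →
    ¬¬-all (λ h → ¬¬-all λ b → ¬¬-all λ i → ¬¬-all λ j → ¬¬-excluded-middle) λ event? →
    n∸1≰k (count⇒n∸1≤k 3≤n (covering-count E event? (cover event?)))
    where
    D⊆H : ∀ h {v w} → Adj (D n) v w → Adj (H h) v w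
    D⊆H h {v} {w} vw = to (D≡∩H v w λ { refl → irrefl (D n) {v} vw }) vw h

    E : Fin k → Events n
    E h = events (S h) (D⊆H h)

    cover : (∀ h b i j → Dec (Events.Event (E h) b i j)) →
            ∀ {i j} → i ≢ j → ∃[ h ] ∃[ b ] Events.Event (E h) b i j
    cover event? {i} {j} i≢j =
      decidable-stable (any? λ h → any? λ b → event? h b i j) λ ¬event →
      -- Without an event every graph would, up to double negation, join `pair i j` to `pair i i`,
      -- and so would `D n`, although both sets contain `i`.
      ¬¬-all (λ h ¬adj → Separation.separated (S h) (pair≢singleton i≢j) ¬adj
                           λ (b , sep) → ¬event (h , b , i≢j , sep))
        λ adj → meet⇒¬adj {i} {j} {i} {i} (i , inj₁ refl , inj₁ refl)
                  (from (D≡∩H (pair i j) (pair i i) (pair≢singleton i≢j)) adj)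

-- Threshold graphs with natural weights

m∸n≤o⇒m≤n+o : ∀ m n {o} → m ∸ n ≤ o → m ≤ n + o
m∸n≤o⇒m≤n+o m n m∸n≤o = ℕ.≤-trans (ℕ.m≤n+m∸n m n) (ℕ.+-monoʳ-≤ n m∸n≤o)

module Endpoints (s M : ℕ) where

  -- Positions come in blocks of length `M`, block `q` running from `q * M + 1` to `q * M + M`. A
  -- light vertex is a point of block `s ∸ c`, placed there by its code; a heavy one reaches to the
  -- end of block `c`.
  endpoints : ∀ c → ℕ → Dec (s ≤ c + c) → ℕ × ℕ
  endpoints c code (yes _) = 0 , c * M + M
  endpoints c code (no _)  = (s ∸ c) * M + suc code , (s ∸ c) * M + suc code

  lo≤hi : ∀ c code c? → proj₁ (endpoints c code c?) ≤ proj₂ (endpoints c code c?)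
  lo≤hi c code (yes _) = z≤n
  lo≤hi c code (no _)  = ℕ.≤-refl

  digit-mono : ∀ {p q r} → r < M → p ≤ q → p * M + suc r ≤ q * M + M
  digit-mono r<M p≤q = ℕ.+-mono-≤ (ℕ.*-monoˡ-≤ M p≤q) r<M

  digit-cancel : ∀ p q {r} → p * M + suc r ≤ q * M + M → p ≤ q
  digit-cancel p q {r} le = ℕ.≮⇒≥ λ q<p → ℕ.<⇒≱ (begin-strict
    q * M + M       ≡⟨ ℕ.+-comm (q * M) M ⟩
    suc q * M       ≤⟨ ℕ.*-monoˡ-≤ M q<p ⟩
    p * M           <⟨ ℕ.m<m+n (p * M) (s≤s z≤n) ⟩
    p * M + suc r   ∎) le
    where open ℕ.≤-Reasoning

  Overlap : ℕ × ℕ → ℕ × ℕ → Set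
  Overlap (lo , hi) (lo′ , hi′) = lo ≤ hi′ × lo′ ≤ hi

  -- Two heavy vertices always overlap and have weight sum at least `s`; two light ones are distinct
  -- points with sum below `s`. In the mixed case the blocks are compared, for instance `s ∸ b ≤ a`.
  intersect⇔ : ∀ a b {r t} a? b? → r < M → t < M → r ≢ t →
             Overlap (endpoints a r a?) (endpoints b t b?) ⇔ s ≤ a + b
  intersect⇔ a b (yes s≤2a) (yes s≤2b) _ _ _ = mk⇔ (λ _ → s≤a+b) (λ _ → z≤n , z≤n)
    where
    s≤a+b : s ≤ a + b
    s≤a+b with ℕ.≤-total a b
    ... | inj₁ a≤b = ℕ.≤-trans s≤2a (ℕ.+-monoʳ-≤ a a≤b)
    ... | inj₂ b≤a = ℕ.≤-trans s≤2b (ℕ.+-monoˡ-≤ b b≤a)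
  intersect⇔ a b (yes _) (no _) _ t<M _ = mk⇔
    (λ (_ , le) → subst (s ≤_) (ℕ.+-comm b a) (m∸n≤o⇒m≤n+o s b (digit-cancel (s ∸ b) a le)))
    (λ s≤a+b → z≤n , digit-mono t<M (ℕ.m≤n+o⇒m∸n≤o s b (subst (s ≤_) (ℕ.+-comm a b) s≤a+b)))
  intersect⇔ a b (no _) (yes _) r<M _ _ = mk⇔
    (λ (le , _) → m∸n≤o⇒m≤n+o s a (digit-cancel (s ∸ a) b le))
    (λ s≤a+b → digit-mono r<M (ℕ.m≤n+o⇒m∸n≤o s a s≤a+b) , z≤n)
  intersect⇔ a b {r} {t} (no s≰2a) (no s≰2b) r<M t<M r≢t = mk⇔
    (λ (le , ge) → contradiction (codes-equal le ge) r≢t)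
    (λ s≤a+b → contradiction s≤a+b s≰a+b)
    where
    codes-equal : (s ∸ a) * M + suc r ≤ (s ∸ b) * M + suc t →
                  (s ∸ b) * M + suc t ≤ (s ∸ a) * M + suc r → r ≡ t
    codes-equal le ge = ℕ.suc-injective (ℕ.+-cancelˡ-≡ ((s ∸ a) * M) (suc r) (suc t)
      (trans (ℕ.≤-antisym le ge) (cong (λ q → q * M + suc t) (sym s∸a≡s∸b))))
      where
      s∸a≡s∸b : s ∸ a ≡ s ∸ b
      s∸a≡s∸b = ℕ.≤-antisym
        (digit-cancel (s ∸ a) (s ∸ b) (ℕ.≤-trans le (ℕ.+-monoʳ-≤ ((s ∸ b) * M) t<M)))
        (digit-cancel (s ∸ b) (s ∸ a) (ℕ.≤-trans ge (ℕ.+-monoʳ-≤ ((s ∸ a) * M) r<M)))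

    s≰a+b : ¬ s ≤ a + b
    s≰a+b s≤a+b with ℕ.≤-total a b
    ... | inj₁ a≤b = s≰2b (ℕ.≤-trans s≤a+b (ℕ.+-monoˡ-≤ b a≤b))
    ... | inj₂ b≤a = s≰2a (ℕ.≤-trans s≤a+b (ℕ.+-monoʳ-≤ a b≤a))

module _ {V : FiniteSet} where

  open FiniteSet V using (elements; complete)

  code : Carrier V → ℕ
  code v = toℕ (index (complete v))

  code-injective : ∀ {v w} → code v ≡ code w → v ≡ w
  code-injective {v} {w} eq = begin
    v                                    ≡⟨ lookup-index (complete v) ⟩
    lookup elements (index (complete v)) ≡⟨ cong (lookup elements) (toℕ-injective eq) ⟩
    lookup elements (index (complete w)) ≡⟨ lookup-index (complete w) ⟨
    w                                    ∎
    where open ≡-Reasoning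

  -- Such a graph is both a threshold and an interval graph, so one family serves both upper bounds.
  weightGraph : (Carrier V → ℕ) → ℕ → Graph V
  weightGraph c s = record
    { Adj    = λ v w → v ≢ w × s ≤ c v + c w
    ; symm   = λ {v} {w} (v≢w , le) → v≢w ∘ sym , subst (s ≤_) (ℕ.+-comm (c v) (c w)) le
    ; irrefl = λ (v≢v , _) → v≢v refl
    }

  weightGraph-threshold : ∀ c s → IsThresholdGraph (weightGraph c s)
  weightGraph-threshold c s = natᴿ ∘ c , natᴿ s , λ v w → mk⇔
    (λ (v≢w , le) → v≢w , const-mono (subst (fromℕ s ℚ.≤_) (fromℕ-+ (c v) (c w)) (fromℕ-mono le)))
    (λ (v≢w , le) → v≢w ,
      fromℕ-cancel (subst (fromℕ s ℚ.≤_) (sym (fromℕ-+ (c v) (c w))) (const-cancel le)))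

  -- Heavy vertices (s ≤ 2c) get nested intervals from 0, light vertices
  -- distinct points whose position is measured by s − c.
  weightGraph-interval : ∀ c s → IsIntervalGraph (weightGraph c s)
  weightGraph-interval c s = I , λ v w → mk⇔
    (λ (v≢w , le) → v≢w , overlap⇒∩ v w (from (intersect v≢w) le))
    (λ (v≢w , v∩w) → v≢w , to (intersect v≢w) (∩⇒overlap v w v∩w))
    where
    open Endpoints s (length elements)

    ends : Carrier V → ℕ × ℕ
    ends v = endpoints (c v) (code v) (s ℕ.≤? c v + c v)

    lo hi : Carrier V → ℕ
    lo = proj₁ ∘ ends
    hi = proj₂ ∘ ends

    ends-ordered : ∀ v → lo v ≤ hi v
    ends-ordered v = lo≤hi (c v) (code v) (s ℕ.≤? c v + c v)

    I : Carrier V → Interval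
    I v = record
      { lower       = natᴿ (lo v)
      ; upper       = natᴿ (hi v)
      ; lower≤upper = natᴿ-mono (ends-ordered v)
      }

    intersect : ∀ {v w} → v ≢ w → Overlap (ends v) (ends w) ⇔ s ≤ c v + c w
    intersect {v} {w} v≢w = intersect⇔ (c v) (c w) (s ℕ.≤? c v + c v) (s ℕ.≤? c w + c w)
      (toℕ<n (index (complete v))) (toℕ<n (index (complete w))) (v≢w ∘ code-injective)

    overlap⇒∩ : ∀ v w → Overlap (ends v) (ends w) → ∃[ x ] x ∈ᴵ I v × x ∈ᴵ I w
    overlap⇒∩ v w (lv≤hw , lw≤hv) = natᴿ (lo v ⊔ lo w)
      , (natᴿ-mono (ℕ.m≤m⊔n (lo v) (lo w)) , natᴿ-mono (ℕ.⊔-lub (ends-ordered v) lw≤hv))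
      , (natᴿ-mono (ℕ.m≤n⊔m (lo v) (lo w)) , natᴿ-mono (ℕ.⊔-lub lv≤hw (ends-ordered w)))

    ∩⇒overlap : ∀ v w → ∃[ x ] (x ∈ᴵ I v × x ∈ᴵ I w) → Overlap (ends v) (ends w)
    ∩⇒overlap v w (x , (lv≤x , x≤hv) , (lw≤x , x≤hw)) =
      natᴿ-cancel (≤ᴿ-trans (natᴿ (lo v)) x (natᴿ (hi w)) lv≤x x≤hw) ,
      natᴿ-cancel (≤ᴿ-trans (natᴿ (lo w)) x (natᴿ (hi v)) lw≤x x≤hv)

-- Upper bound for `D (suc d)`

module UpperBound (d : ℕ) where

  penalty : ℕ → Bool → ℕ
  penalty k b = if b then 0 else k

  weight : Fin d → Subset (suc d) → ℕ
  weight j p = penalty 2 (Vec.lookup p (suc j)) + penalty 1 (Vec.lookup p zero)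

  penalty-disjoint : ∀ k a b → ¬ (a ≡ true × b ≡ true) → k ≤ penalty k a + penalty k b
  penalty-disjoint k true  true  ¬ab = contradiction (refl , refl) ¬ab
  penalty-disjoint k true  false _   = ℕ.≤-refl
  penalty-disjoint k false b     _   = ℕ.m≤m+n k _

  -- At least one of two disjoint sets misses `suc j` and at least one misses `zero`, contributing 2
  -- and 1. Regrouping by element instead of by set exposes this.
  disjoint⇒heavy : ∀ j p q → Empty (p ∩ q) → 3 ≤ weight j p + weight j q
  disjoint⇒heavy j p q p∩q=∅ = subst (3 ≤_)
    (interchange ℕ.+-commutativeSemigroup
      (penalty 2 (Vec.lookup p (suc j))) (penalty 2 (Vec.lookup q (suc j)))
      (penalty 1 (Vec.lookup p zero)) (penalty 1 (Vec.lookup q zero)))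
    (ℕ.+-mono-≤ (at 2 (suc j)) (at 1 zero))
    where
    at : ∀ k x → k ≤ penalty k (Vec.lookup p x) + penalty k (Vec.lookup q x)
    at k x = penalty-disjoint k _ _ λ (px , qx) →
      p∩q=∅ (x , x∈p∩q⁺ (lookup⇒[]= x p px , lookup⇒[]= x q qx))

  -- The zeros are the payments for the shared element `zero`; with 0 or 2 from each set, only 2 + 2
  -- reaches 3.
  both-miss : ∀ a b → 3 ≤ (penalty 2 a + 0) + (penalty 2 b + 0) → a ≢ true × b ≢ true
  both-miss true  true  ()
  both-miss true  false (s≤s (s≤s ()))
  both-miss false true  (s≤s (s≤s ()))
  both-miss false false _ = (λ ()) , (λ ())

  not-both : ∀ {a b} x y → a ≡ true → b ≡ true →
             ¬ 3 ≤ (penalty 2 a + penalty 1 x) + (penalty 2 b + penalty 1 y)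
  not-both true  true  refl refl ()
  not-both true  false refl refl (s≤s ())
  not-both false true  refl refl (s≤s ())
  not-both false false refl refl (s≤s (s≤s ()))

  heavy⇒disjoint : ∀ p q → p ≢ q → (∀ j → 3 ≤ weight j p + weight j q) → Empty (p ∩ q)
  heavy⇒disjoint p q p≢q heavy (suc j , x∈) with x∈p∩q⁻ p q x∈
  ... | x∈p , x∈q = not-both (Vec.lookup p zero) (Vec.lookup q zero)
                             ([]=⇒lookup x∈p) ([]=⇒lookup x∈q) (heavy j)
  -- When `zero` is shared, neither set can contain any `suc j`, so both would be the singleton of
  -- `zero`.
  heavy⇒disjoint (inside ∷ p) (inside ∷ q) p≢q heavy (zero , here) =
    p≢q (cong (inside ∷_) (trans (Empty-unique p-empty) (sym (Empty-unique q-empty))))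
    where
    p-empty : Empty p
    p-empty (j , j∈p) = proj₁ (both-miss (Vec.lookup p j) (Vec.lookup q j) (heavy j)) ([]=⇒lookup j∈p)
    q-empty : Empty q
    q-empty (j , j∈q) = proj₂ (both-miss (Vec.lookup p j) (Vec.lookup q j) (heavy j)) ([]=⇒lookup j∈q)

  H : Fin d → Graph (vertexSet (suc d))
  H j = weightGraph (weight j ∘ value) 3

  D≡∩H : IsIntersection (D (suc d)) H
  D≡∩H v w v≢w = mk⇔
    (λ vw j → v≢w , disjoint⇒heavy j (value v) (value w) vw)
    (λ heavy → heavy⇒disjoint (value v) (value w) (v≢w ∘ value-injective) (proj₂ ∘ heavy))

  boxicity≤ : IsIntersectionOf IsIntervalGraph (D (suc d)) d
  boxicity≤ = H , (λ j → weightGraph-interval {vertexSet (suc d)} (weight j ∘ value) 3) , D≡∩H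

  thresholdDimension≤ : IsIntersectionOf IsThresholdGraph (D (suc d)) d
  thresholdDimension≤ = H , (λ j → weightGraph-threshold {vertexSet (suc d)} (weight j ∘ value) 3) , D≡∩H

⊤-not-vertex : ∀ {n} → ¬ IsVertex (⊤ {n})
⊤-not-vertex (_ , _ , _ , _ , x∉⊤) = x∉⊤ ∈⊤

⊥-not-vertex : ∀ {n} → ¬ IsVertex (Subset.⊥ {n})
⊥-not-vertex ((_ , x∈⊥) , _) = ∉⊥ x∈⊥

D₂-complete : ∀ v w → v ≢ w → Adj (D 2) v w
D₂-complete (inside  ∷ inside  ∷ [] , irr v) _ _ = ⊥-elim-irr (⊤-not-vertex v)
D₂-complete (outside ∷ outside ∷ [] , irr v) _ _ = ⊥-elim-irr (⊥-not-vertex v)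
D₂-complete _ (inside  ∷ inside  ∷ [] , irr w) _ = ⊥-elim-irr (⊤-not-vertex w)
D₂-complete _ (outside ∷ outside ∷ [] , irr w) _ = ⊥-elim-irr (⊥-not-vertex w)
D₂-complete (inside  ∷ outside ∷ [] , _) (outside ∷ inside  ∷ [] , _) _ (_ , there (there ()))
D₂-complete (outside ∷ inside  ∷ [] , _) (inside  ∷ outside ∷ [] , _) _ (_ , there (there ()))
D₂-complete (inside  ∷ outside ∷ [] , _) (inside  ∷ outside ∷ [] , _) v≢w = contradiction refl v≢w
D₂-complete (outside ∷ inside  ∷ [] , _) (outside ∷ inside  ∷ [] , _) v≢w = contradiction refl v≢w

theorem10 : (∀ n → n ≡ 1 ⊎ n ≡ 2 →
    HasBoxicity (D n) 0 × HasThresholdDimension (D n) 0)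
    ×
    (∀ n → 3 ≤ n →
    HasBoxicity (D n) (n ∸ 1) × HasThresholdDimension (D n) (n ∸ 1))
theorem10 = complete-cases , main
  where
  complete-cases : ∀ n → n ≡ 1 ⊎ n ≡ 2 → HasBoxicity (D n) 0 × HasThresholdDimension (D n) 0
  -- For `n = 1` the general family, with `d = 0`, is already empty.
  complete-cases _ (inj₁ refl) =
    (UpperBound.boxicity≤ 0 , λ _ _ → z≤n) , (UpperBound.thresholdDimension≤ 0 , λ _ _ → z≤n)
  -- For `n = 2` the general family has one member, so the completeness of `D 2` is used instead.
  complete-cases _ (inj₂ refl) =
    ((none , (λ ()) , D≡∩∅) , λ _ _ → z≤n) , ((none , (λ ()) , D≡∩∅) , λ _ _ → z≤n)
    where
    none : Fin 0 → Graph (vertexSet 2)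
    none ()

    D≡∩∅ : IsIntersection (D 2) none
    D≡∩∅ v w v≢w = mk⇔ (λ _ ()) (λ _ → D₂-complete v w v≢w)

  main : ∀ n → 3 ≤ n → HasBoxicity (D n) (n ∸ 1) × HasThresholdDimension (D n) (n ∸ 1)
  main n@(suc d) 3≤n =
    (UpperBound.boxicity≤ d ,
      λ k (H , interval , D≡∩H) → n∸1≤ H (interval⇒separation ∘ interval) D≡∩H) ,
    (UpperBound.thresholdDimension≤ d ,
      λ k (H , threshold , D≡∩H) → n∸1≤ H (threshold⇒separation ∘ threshold) D≡∩H)
    where open LowerBound 3≤n
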